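{- Let $x$ be a PGLBbt instruction sequence and let $u$ be a service family. Then: (1) if $x\bullet u=\mathsf T$, then $\mathrm{swap}(x)\bullet u=\mathsf F$ and $\mathrm{f2d}(x)\bullet u=\mathsf T$; (2) if $x\bullet u=\mathsf F$, then $\mathrm{swap}(x)\bullet u=\mathsf T$ and $\mathrm{f2d}(x)\bullet u=\mathsf{Div}$.
   Context: PGLBbt instruction sequences. Fix a nonempty finite set of foci and a set of methods. A basic instruction is written $f.m$ with $f$ a focus and $m$ a method. A PGLBbt instruction sequence is a finite nonempty sequence $x=u_1;\dots;u_k$ of primitive instructions, each of one of the forms: $a$ (plain basic instruction), $+a$ (positive test), $-a$ (negative test), for a basic instruction $a$; $\#l$ (forward jump) or $\backslash\#l$ (backward jump), for $l\in\mathbb N$; $!t$ (positive termination); $!f$ (negative termination). Transformations. $\mathrm{swap}(x)$ is $x$ with every occurrence of $!t$ replaced by $!f$ and every occurrence of $!f$ replaced by $!t$. $\mathrm{f2d}(x)$ is $x$ with every occurrence of $!f$ replaced by $\#0$. Threads. Finite threads are terms built from the constants $\mathsf D$ (deadlock), $\mathsf S_+$ (termination delivering true), $\mathsf S_-$ (termination delivering false) and, for each basic instruction (action) $a$, the binary postconditional composition $p\unlhd a\unrhd q$ (perform $a$, then continue as $p$ if the reply is true and as $q$ if it is false); $a\circ p$ abbreviates $p\unlhd a\unrhd p$. General (possibly infinite) threads are the solutions of guarded recursive specifications; two threads are equal iff all their projections are equal, where $\pi_0(p)=\mathsf D$, $\pi_{n+1}(c)=c$ for $c\in\{\mathsf D,\mathsf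 S_+,\mathsf S_-\}$, and $\pi_{n+1}(p\unlhd a\unrhd q)=\pi_n(p)\unlhd a\unrhd\pi_n(q)$. Thread extraction. For $x=u_1;\dots;u_k$, $|x|=|1,x|$, where: $|i,x|=\mathsf D$ if not $1\le i\le k$; $|i,x|=a\circ|i+1,x|$ if $u_i=a$; $|i,x|=|i+1,x|\unlhd a\unrhd|i+2,x|$ if $u_i=+a$; $|i,x|=|i+2,x|\unlhd a\unrhd|i+1,x|$ if $u_i=-a$; $|i,x|=|i+l,x|$ if $u_i=\#l$; $|i,x|=|i\dot{ - }l,x|$ if $u_i=\backslash\#l$ ($\dot-$ truncated subtraction); $|i,x|=\mathsf S_+$ if $u_i=!t$; $|i,x|=\mathsf S_-$ if $u_i=!f$; and $|i,x|=\mathsf D$ whenever $u_i$ is the beginning of an infinite chain of jumps. Services and service families. A service $H$ has, for each method $m$, a derived service $\partial_m H$ and a reply $\rho_m(H)\in\{\mathsf T,\mathsf F,\mathsf{Div}\}$. A service family is a finite set of services each named by a focus, distinct services having distinct names. For a family $u$ containing a service $H$ named $f$, $u[f:=H']$ is $u$ with that service replaced by $H'$. Reply. For a finite thread $p$ and a service family $u$, $p\bullet u\in\{\mathsf T,\mathsf F,\mathsf{Div}\}$ is defined by: $\mathsf S_+\bullet u=\mathsf T$, $\mathsf S_-\bullet u=\mathsf F$, $\mathsf D\bullet u=\mathsf{Div}$; $(p\unlhd f.m\unrhd q)\bullet u=\mathsf{Div}$ if $u$ has no service named $f$; if $u$ has a service $H$ named $f$, then $(p\unlhd f.m\unrhd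 q)\bullet u$ equals $p\bullet u[f:=\partial_mH]$ if $\rho_m(H)=\mathsf T$, $q\bullet u[f:=\partial_mH]$ if $\rho_m(H)=\mathsf F$, and $\mathsf{Div}$ if $\rho_m(H)=\mathsf{Div}$. For a general thread $x$, $x\bullet u$ is the value that $\pi_n(x)\bullet u$ takes for all sufficiently large $n$. For an instruction sequence $x$, $x\bullet u:=|x|\bullet u$. -}

module Defs where

open import Data.Nat using (ℕ; zero; suc; _+_; _∸_; _≤_; _<?_)
open import Data.Fin using (Fin)
open import Data.Fin.Properties using (_≟_)
open import Data.List using (List; length; lookup)
open import Data.List.NonEmpty using (List⁺; toList; map)
open import Data.Maybe using (Maybe; just; nothing)
open import Data.Product using (∃; _×_)
open import Relation.Binary.PropositionalEquality using (_≡_)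
open import Relation.Nullary using (yes; no)

module PGLBbt (nf : ℕ) (Method : Set) where

  Focus : Set
  Focus = Fin (suc nf)

  record BasicInstr : Set where
    constructor _·_
    field
      focus  : Focus
      method : Method

  data Instr : Set where
    plain  : BasicInstr → Instr
    ptest  : BasicInstr → Instr
    ntest  : BasicInstr → Instr
    fjmp   : ℕ → Instr
    bjmp   : ℕ → Instr
    termT  : Instr
    termF  : Instr

  InstrSeq : Set
  InstrSeq = List⁺ Instr

  swapI : Instr → Instr
  swapI termT = termF
  swapI termF = termT
  swapI u     = u

  swap : InstrSeq → InstrSeq
  swap = map swapI

  f2dI : Instr → Instr
  f2dI termF = fjmp 0
  f2dI u     = u

  f2d : InstrSeq → InstrSeq
  f2d = map f2dI

  -- Finite threads.  (Coinduction is unavailable in this setting; a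
  -- general thread is determined by its projections π_n, so the thread
  -- |x| is represented below through its projections π_n(|i,x|).)
  data FThread : Set where
    D  : FThread
    S+ : FThread
    S- : FThread
    pc : FThread → BasicInstr → FThread → FThread

  -- Thread extraction |i,x|  (positions are 1-based)

  instrAt : InstrSeq → ℕ → Maybe Instr
  instrAt x zero = nothing
  instrAt x (suc j) with j <? length (toList x)
  ... | yes j<k = just (lookup (toList x) (Data.Fin.fromℕ< j<k))
  ... | no  _   = nothing

  data Target : Set where
    tD  : Target
    tS+ : Target
    tS- : Target
    tPC : BasicInstr → ℕ → ℕ → Target   -- action, true-continuation, false-continuation

  -- follow jumps from position i with the given fuel; running out of
  -- fuel after length x + 1 jumps means an infinite chain of jumps
  resolve′ : InstrSeq → ℕ → ℕ → Target
  resolve′ x zero    i = tD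
  resolve′ x (suc n) i with instrAt x i
  ... | nothing         = tD
  ... | just (plain a)  = tPC a (suc i) (suc i)
  ... | just (ptest a)  = tPC a (suc i) (suc (suc i))
  ... | just (ntest a)  = tPC a (suc (suc i)) (suc i)
  ... | just (fjmp l)   = resolve′ x n (i + l)
  ... | just (bjmp l)   = resolve′ x n (i ∸ l)
  ... | just termT      = tS+
  ... | just termF      = tS-

  resolve : InstrSeq → ℕ → Target
  resolve x i = resolve′ x (suc (length (toList x))) i

  -- πext n x i = π_n(|i,x|), by the defining equations of thread
  -- extraction and of the projections:
  --   π_0(p) = D, π_{n+1}(p ⊴ a ⊵ q) = π_n(p) ⊴ a ⊵ π_n(q), constants fixed.
  πext : ℕ → InstrSeq → ℕ → FThread
  πext zero    x i = D
  πext (suc n) x i with resolve x i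
  ... | tD        = D
  ... | tS+       = S+
  ... | tS-       = S-
  ... | tPC a j k = pc (πext n x j) a (πext n x k)

  π∣_∣ : ℕ → InstrSeq → FThread
  π∣_∣ n x = πext n x 1

  data Reply : Set where
    T F Div : Reply

  -- a service, as a state of a (deterministic) state machine: the
  -- derived service ∂_m H is the state reached by m, and ρ_m(H) the reply.
  record Service : Set₁ where
    field
      State : Set
      state : State
      next  : State → Method → State
      reply : State → Method → Reply

  ∂ : Service → Method → Service
  ∂ H m = record H { state = Service.next H (Service.state H) m }

  ρ : Service → Method → Reply
  ρ H m = Service.reply H (Service.state H) m

  -- a service family: for each focus, at most one service named by it
  -- (the set of foci is finite, so the family is finite)
  Family : Set₁
  Family = Focus → Maybe Service

  update : Family → Focus → Service → Family
  update u f H g with g ≟ f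
  ... | yes _ = just H
  ... | no  _ = u g

  applyF : FThread → Family → Reply
  applyF D  u = Div
  applyF S+ u = T
  applyF S- u = F
  applyF (pc p (f · m) q) u with u f
  ... | nothing = Div
  ... | just H with ρ H m
  ...   | T   = applyF p (update u f (∂ H m))
  ...   | F   = applyF q (update u f (∂ H m))
  ...   | Div = Div

  _•_≈_ : InstrSeq → Family → Reply → Set
  x • u ≈ v = ∃ λ N → ∀ n → N ≤ n → applyF (π∣ n ∣ x) u ≡ v

-- swap and f2d only relabel the exits !t and !f of an instruction sequence: swap exchanges
-- them, f2d turns !f into the self-jump #0, which extraction sees as an infinite jump chain,
-- i.e. as D.  Relabelling the exits of x by an outcome map r therefore relabels the leaves
-- S+, S-, D of every projection of |x| by r, and (provided r keeps Div fixed) this turns the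
-- reply T, F or Div of each projection into its image under r.
module Submission where

open import Defs
open import Data.Nat using (ℕ; zero; suc; _+_; _∸_; _<_; _<?_; s≤s)
open import Data.Nat.Properties using (+-identityʳ)
open import Data.Product using (_×_; _,_)
open import Data.Fin using (fromℕ<)
open import Data.List as List using (List; _∷_; length; lookup)
open import Data.List.Properties using (length-map)
open import Data.List.NonEmpty as List⁺ using (toList; _∷_)
open import Data.Maybe as Maybe using (just; nothing)
open import Data.Maybe.Properties as Maybe using ()
open import Relation.Binary.PropositionalEquality
open import Relation.Nullary using (yes; no)
open import Relation.Nullary.Negation using (contradiction)

lookup-map : ∀ {A B : Set} (g : A → B) (xs : List A) (j : ℕ)
             (j<xs : j < length xs) (j<gxs : j < length (List.map g xs)) →
             lookup (List.map g xs) (fromℕ< j<gxs) ≡ g (lookup xs (fromℕ< j<xs))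
lookup-map g (x ∷ xs) zero    _          _           = refl
lookup-map g (x ∷ xs) (suc j) (s≤s j<xs) (s≤s j<gxs) = lookup-map g xs j j<xs j<gxs

module ExitRelabelling (nf : ℕ) (Method : Set) where
  open PGLBbt nf Method

  exitInstr : Reply → Instr
  exitInstr T   = termT
  exitInstr F   = termF
  exitInstr Div = fjmp 0

  exitTarget : Reply → Target
  exitTarget T   = tS+
  exitTarget F   = tS-
  exitTarget Div = tD

  exitThread : Reply → FThread
  exitThread T   = S+
  exitThread F   = S-
  exitThread Div = D

  relabelInstr : (Reply → Reply) → Instr → Instr
  relabelInstr r termT = exitInstr (r T)
  relabelInstr r termF = exitInstr (r F)
  relabelInstr r u     = u

  relabelTarget : (Reply → Reply) → Target → Target
  relabelTarget r tS+ = exitTarget (r T)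
  relabelTarget r tS- = exitTarget (r F)
  relabelTarget r t   = t

  relabelThread : (Reply → Reply) → FThread → FThread
  relabelThread r D          = D
  relabelThread r S+         = exitThread (r T)
  relabelThread r S-         = exitThread (r F)
  relabelThread r (pc p a q) = pc (relabelThread r p) a (relabelThread r q)

  length-toList-map : (g : Instr → Instr) (x : InstrSeq) →
                      length (toList (List⁺.map g x)) ≡ length (toList x)
  length-toList-map g (_ ∷ xs) = cong suc (length-map g xs)

  instrAt-map : (g : Instr → Instr) (x : InstrSeq) (i : ℕ) →
                instrAt (List⁺.map g x) i ≡ Maybe.map g (instrAt x i)
  instrAt-map g x zero = refl
  instrAt-map g x (suc j) with j <? length (toList x) | j <? length (toList (List⁺.map g x))
  ... | yes j<x | yes j<gx = cong just (lookup-map g (toList x) j j<x j<gx)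
  ... | yes j<x | no  j≮gx = contradiction (subst (j <_) (sym (length-toList-map g x)) j<x) j≮gx
  ... | no  j≮x | yes j<gx = contradiction (subst (j <_) (length-toList-map g x) j<gx) j≮x
  ... | no  _   | no  _    = refl

  resolve′-selfJump : (y : InstrSeq) (n i : ℕ) → instrAt y i ≡ just (fjmp 0) → resolve′ y n i ≡ tD
  resolve′-selfJump y zero    i _  = refl
  resolve′-selfJump y (suc n) i eq rewrite eq | +-identityʳ i = resolve′-selfJump y n i eq

  resolve′-exit : (y : InstrSeq) (n i : ℕ) (v : Reply) →
                  instrAt y i ≡ just (exitInstr v) → resolve′ y (suc n) i ≡ exitTarget v
  resolve′-exit y n i T   eq rewrite eq = refl
  resolve′-exit y n i F   eq rewrite eq = refl
  resolve′-exit y n i Div eq rewrite eq | +-identityʳ i = resolve′-selfJump y n i eq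

  πext-exit : (y : InstrSeq) (n i : ℕ) (v : Reply) →
              resolve y i ≡ exitTarget v → πext (suc n) y i ≡ exitThread v
  πext-exit y n i T   eq rewrite eq = refl
  πext-exit y n i F   eq rewrite eq = refl
  πext-exit y n i Div eq rewrite eq = refl

  applyF-exitThread : (v : Reply) (u : Family) → applyF (exitThread v) u ≡ v
  applyF-exitThread T   u = refl
  applyF-exitThread F   u = refl
  applyF-exitThread Div u = refl

  module _ {g : Instr → Instr} {r : Reply → Reply} (g≗r : g ≗ relabelInstr r) where

    instrAt-relabel : (x : InstrSeq) (i : ℕ) →
                      instrAt (List⁺.map g x) i ≡ Maybe.map (relabelInstr r) (instrAt x i)
    instrAt-relabel x i = trans (instrAt-map g x i) (Maybe.map-cong g≗r (instrAt x i))

    resolve′-relabel : (x : InstrSeq) (n i : ℕ) →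
                       resolve′ (List⁺.map g x) n i ≡ relabelTarget r (resolve′ x n i)
    resolve′-relabel x zero    i = refl
    resolve′-relabel x (suc n) i with instrAt x i in eq
    ... | nothing        rewrite instrAt-relabel x i | eq = refl
    ... | just (plain a) rewrite instrAt-relabel x i | eq = refl
    ... | just (ptest a) rewrite instrAt-relabel x i | eq = refl
    ... | just (ntest a) rewrite instrAt-relabel x i | eq = refl
    ... | just (fjmp l)  rewrite instrAt-relabel x i | eq = resolve′-relabel x n (i + l)
    ... | just (bjmp l)  rewrite instrAt-relabel x i | eq = resolve′-relabel x n (i ∸ l)
    ... | just termT = resolve′-exit _ n i (r T) (trans (instrAt-relabel x i) (cong (Maybe.map _) eq))
    ... | just termF = resolve′-exit _ n i (r F) (trans (instrAt-relabel x i) (cong (Maybe.map _) eq))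

    resolve-relabel : (x : InstrSeq) (i : ℕ) →
                      resolve (List⁺.map g x) i ≡ relabelTarget r (resolve x i)
    resolve-relabel x i rewrite length-toList-map g x = resolve′-relabel x _ i

    πext-relabel : (n : ℕ) (x : InstrSeq) (i : ℕ) →
                   πext n (List⁺.map g x) i ≡ relabelThread r (πext n x i)
    πext-relabel zero    x i = refl
    πext-relabel (suc n) x i with resolve x i in eq
    ... | tD        rewrite resolve-relabel x i | eq = refl
    ... | tS+       = πext-exit _ n i (r T) (trans (resolve-relabel x i) (cong (relabelTarget r) eq))
    ... | tS-       = πext-exit _ n i (r F) (trans (resolve-relabel x i) (cong (relabelTarget r) eq))
    ... | tPC a j k rewrite resolve-relabel x i | eq =
      cong₂ (λ p q → pc p a q) (πext-relabel n x j) (πext-relabel n x k)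

  applyF-relabel : (r : Reply → Reply) → r Div ≡ Div →
                   (p : FThread) (u : Family) → applyF (relabelThread r p) u ≡ r (applyF p u)
  applyF-relabel r strict D  u = sym strict
  applyF-relabel r strict S+ u = applyF-exitThread (r T) u
  applyF-relabel r strict S- u = applyF-exitThread (r F) u
  applyF-relabel r strict (pc p (f · m) q) u with u f
  ... | nothing = sym strict
  ... | just H with ρ H m
  ...   | T   = applyF-relabel r strict p _
  ...   | F   = applyF-relabel r strict q _
  ...   | Div = sym strict

  •-relabel : {g : Instr → Instr} {r : Reply → Reply} → g ≗ relabelInstr r → r Div ≡ Div →
              {x : InstrSeq} {u : Family} {v : Reply} → x • u ≈ v → List⁺.map g x • u ≈ r v
  •-relabel {r = r} g≗r strict {x} {u} (N , x•u≡v) = N , λ n N≤n → begin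
    applyF (π∣ n ∣ (List⁺.map _ x)) u       ≡⟨ cong (λ p → applyF p u) (πext-relabel g≗r n x 1) ⟩
    applyF (relabelThread r (π∣ n ∣ x)) u   ≡⟨ applyF-relabel r strict (π∣ n ∣ x) u ⟩
    r (applyF (π∣ n ∣ x) u)                 ≡⟨ cong r (x•u≡v n N≤n) ⟩
    r _                                     ∎
    where open ≡-Reasoning

  swapReply : Reply → Reply
  swapReply T   = F
  swapReply F   = T
  swapReply Div = Div

  f2dReply : Reply → Reply
  f2dReply F = Div
  f2dReply v = v

  swapI≗relabel : swapI ≗ relabelInstr swapReply
  swapI≗relabel (plain _) = refl
  swapI≗relabel (ptest _) = refl
  swapI≗relabel (ntest _) = refl
  swapI≗relabel (fjmp _)  = refl
  swapI≗relabel (bjmp _)  = refl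
  swapI≗relabel termT     = refl
  swapI≗relabel termF     = refl

  f2dI≗relabel : f2dI ≗ relabelInstr f2dReply
  f2dI≗relabel (plain _) = refl
  f2dI≗relabel (ptest _) = refl
  f2dI≗relabel (ntest _) = refl
  f2dI≗relabel (fjmp _)  = refl
  f2dI≗relabel (bjmp _)  = refl
  f2dI≗relabel termT     = refl
  f2dI≗relabel termF     = refl

  •-swap : {x : InstrSeq} {u : Family} {v : Reply} → x • u ≈ v → swap x • u ≈ swapReply v
  •-swap = •-relabel swapI≗relabel refl

  •-f2d : {x : InstrSeq} {u : Family} {v : Reply} → x • u ≈ v → f2d x • u ≈ f2dReply v
  •-f2d = •-relabel f2dI≗relabel refl

proposition2 : (nf : ℕ) (Method : Set) → let open PGLBbt nf Method in
    (x : InstrSeq) (u : Family) →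
      (x • u ≈ T → (swap x • u ≈ F) × (f2d x • u ≈ T))
      × (x • u ≈ F → (swap x • u ≈ T) × (f2d x • u ≈ Div))
proposition2 nf Method x u = (λ x•u≈T → •-swap x•u≈T , •-f2d x•u≈T)
                           , (λ x•u≈F → •-swap x•u≈F , •-f2d x•u≈F)
  where open ExitRelabelling nf Method
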